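{- For every $n\ge1$, every Boolean function $f\colon\{0,1\}^n\to\{0,1\}$ has a hazard-free De Morgan formula of size at most $2\cdot 3^n-1$.
   Context: Three-valued logic: let $\mathsf u$ be a third symbol, thought of as $\tfrac12$, so $0<\mathsf u<1$; $x\wedge y=\min(x,y)$, $x\vee y=\max(x,y)$, $\neg x=1-x$ on $\{0,\mathsf u,1\}$. A resolution of $\alpha\in\{0,\mathsf u,1\}^n$ is a string $a\in\{0,1\}^n$ with $a_i=\alpha_i$ whenever $\alpha_i\ne\mathsf u$. The hazard-free extension $\tilde f$ of $f\colon\{0,1\}^n\to\{0,1\}$ is: $\tilde f(\alpha)=c\in\{0,1\}$ if $f(a)=c$ for all resolutions $a$ of $\alpha$, and $\tilde f(\alpha)=\mathsf u$ otherwise. A De Morgan formula is a binary tree whose internal nodes are labeled $\vee$ or $\wedge$ (fan-in two) and whose leaves are labeled by literals (a variable or its negation), evaluated on $\{0,\mathsf u,1\}$-inputs by the rules above. Size is the number of leaves. A formula $F$ computing $f$ is hazard-free if $F(\alpha)=\tilde f(\alpha)$ for all $\alpha\in\{0,\mathsf u,1\}^n$.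
   Formalization: For the two constant functions the formula may use constant leaves 0/1 (counted in the size), since a formula with only literal leaves outputs u on the all-u input and so cannot be hazard-free for them; for every non-constant f all leaves are literals. -}

module Defs where

open import Data.Bool using (Bool; true; false; if_then_else_)
import Data.Bool as Bool
open import Data.Fin using (Fin)
import Data.Fin.Properties as Fin
open import Data.Fin.Subset.Properties using (anySubset?)
open import Data.Nat using (ℕ; _+_)
open import Data.Product using (∃; _×_; _,_)
open import Data.Unit using (⊤)
open import Data.Empty using (⊥)
open import Data.Vec using (Vec; lookup; map)
open import Relation.Binary.Definitions using (DecidableEquality)
open import Relation.Binary.PropositionalEquality using (_≡_; _≢_; refl)
open import Relation.Nullary using (Dec; yes; no; does)
open import Relation.Nullary.Decidable using (map′; ¬?; _→-dec_; decidable-stable)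
open import Relation.Unary using (Pred; Decidable)
open import Level using (0ℓ)

-- Ordered 𝟎 < 𝕦 < 𝟏, with 𝕦 thought of as ½.
data Ternary : Set where
  𝟎 𝕦 𝟏 : Ternary

_≟₃_ : DecidableEquality Ternary
𝟎 ≟₃ 𝟎 = yes refl
𝟎 ≟₃ 𝕦 = no λ ()
𝟎 ≟₃ 𝟏 = no λ ()
𝕦 ≟₃ 𝟎 = no λ ()
𝕦 ≟₃ 𝕦 = yes refl
𝕦 ≟₃ 𝟏 = no λ ()
𝟏 ≟₃ 𝟎 = no λ ()
𝟏 ≟₃ 𝕦 = no λ ()
𝟏 ≟₃ 𝟏 = yes refl

infixr 6 _∧₃_
infixr 5 _∨₃_

_∧₃_ : Ternary → Ternary → Ternary
𝟎 ∧₃ y = 𝟎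
𝟏 ∧₃ y = y
𝕦 ∧₃ 𝟎 = 𝟎
𝕦 ∧₃ 𝕦 = 𝕦
𝕦 ∧₃ 𝟏 = 𝕦

_∨₃_ : Ternary → Ternary → Ternary
𝟎 ∨₃ y = y
𝟏 ∨₃ y = 𝟏
𝕦 ∨₃ 𝟎 = 𝕦
𝕦 ∨₃ 𝕦 = 𝕦
𝕦 ∨₃ 𝟏 = 𝟏

¬₃_ : Ternary → Ternary
¬₃ 𝟎 = 𝟏
¬₃ 𝕦 = 𝕦
¬₃ 𝟏 = 𝟎

⌜_⌝ : Bool → Ternary
⌜ false ⌝ = 𝟎
⌜ true  ⌝ = 𝟏

BooleanFunction : ℕ → Set
BooleanFunction n = Vec Bool n → Bool

_ResolutionOf_ : ∀ {n} → Vec Bool n → Vec Ternary n → Set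
a ResolutionOf α = ∀ i → lookup α i ≢ 𝕦 → ⌜ lookup a i ⌝ ≡ lookup α i

_resolutionOf?_ : ∀ {n} (a : Vec Bool n) (α : Vec Ternary n) → Dec (a ResolutionOf α)
a resolutionOf? α =
  Fin.all? λ i → ¬? (lookup α i ≟₃ 𝕦) →-dec (⌜ lookup a i ⌝ ≟₃ lookup α i)

ConstantOnResolutions : ∀ {n} → BooleanFunction n → Vec Ternary n → Bool → Set
ConstantOnResolutions f α c = ∀ a → a ResolutionOf α → f a ≡ c

-- Subset n is by definition Vec Bool n, so anySubset? searches all Boolean inputs.
allInputs? : ∀ {n} {P : Pred (Vec Bool n) 0ℓ} → Decidable P → Dec (∀ a → P a)
allInputs? P? =
  map′ (λ ∄¬P a → decidable-stable (P? a) λ ¬Pa → ∄¬P (a , ¬Pa))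
       (λ ∀P (a , ¬Pa) → ¬Pa (∀P a))
       (¬? (anySubset? λ a → ¬? (P? a)))

constantOnResolutions? : ∀ {n} (f : BooleanFunction n) α c → Dec (ConstantOnResolutions f α c)
constantOnResolutions? f α c =
  allInputs? λ a → (a resolutionOf? α) →-dec (f a Bool.≟ c)

-- Every α has a resolution, so f cannot be constantly false and constantly true
-- on the resolutions of α; the order of the two tests does not matter.
hazardFreeExtension : ∀ {n} → BooleanFunction n → Vec Ternary n → Ternary
hazardFreeExtension f α =
  if does (constantOnResolutions? f α false) then 𝟎
  else if does (constantOnResolutions? f α true) then 𝟏
  else 𝕦

data Literal (n : ℕ) : Set where
  pos neg : Fin n → Literal n

-- Constant leaves are needed only for constant functions: a formula all of whose
-- leaves are literals evaluates to 𝕦 on the all-𝕦 input, whereas the hazard-free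
-- extension of a constant function is constantly 𝟎 or constantly 𝟏.
data Formula (n : ℕ) : Set where
  lit     : Literal n → Formula n
  const   : Bool → Formula n
  _and_   : Formula n → Formula n → Formula n
  _or_    : Formula n → Formula n → Formula n

OnlyLiteralLeaves : ∀ {n} → Formula n → Set
OnlyLiteralLeaves (lit _)   = ⊤
OnlyLiteralLeaves (const _) = ⊥
OnlyLiteralLeaves (F and G) = OnlyLiteralLeaves F × OnlyLiteralLeaves G
OnlyLiteralLeaves (F or G)  = OnlyLiteralLeaves F × OnlyLiteralLeaves G

-- The number of leaves; constant leaves count too.
size : ∀ {n} → Formula n → ℕ
size (lit _)   = 1
size (const _) = 1
size (F and G) = size F + size G
size (F or G)  = size F + size G

evalLiteral : ∀ {n} → Literal n → Vec Ternary n → Ternary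
evalLiteral (pos i) α = lookup α i
evalLiteral (neg i) α = ¬₃ lookup α i

eval : ∀ {n} → Formula n → Vec Ternary n → Ternary
eval (lit ℓ)   α = evalLiteral ℓ α
eval (const c) α = ⌜ c ⌝
eval (F and G) α = eval F α ∧₃ eval G α
eval (F or G)  α = eval F α ∨₃ eval G α

_Computes_ : ∀ {n} → Formula n → BooleanFunction n → Set
F Computes f = ∀ a → eval F (map ⌜_⌝ a) ≡ ⌜ f a ⌝

_HazardFreeFor_ : ∀ {n} → Formula n → BooleanFunction n → Set
F HazardFreeFor f = F Computes f × (∀ α → eval F α ≡ hazardFreeExtension f α)

IsConstant : ∀ {n} → BooleanFunction n → Set
IsConstant f = ∃ λ c → ∀ a → f a ≡ c

{-# OPTIONS --safe #-}

-- Write f₀ and f₁ for the two restrictions of f to its first variable x, and a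
-- tilde for the hazard-free extension. The formula
--   (¬x ∧ F₀) ∨ ((x ∧ F₁) ∨ F₀₁),  with F₀₁ hazard-free for f₀ ∧ f₁,
-- is hazard-free for f: at x = 𝕦 the consensus term F₀₁ supplies the value 𝟏
-- exactly when f̃₀ = f̃₁ = 𝟏, and at Boolean x it is absorbed. Leaf counts satisfy
-- L(n+1) = 3 L(n) + 2 and L(0) = 1, so L(n) + 1 = 2 · 3ⁿ. Folding constants then
-- changes no value, does not increase the size, and leaves either a single
-- constant or a formula with literal leaves only.
module Submission where

open import Defs
open import Data.Nat using (ℕ; _≤_; _*_; _^_; _∸_)
open import Data.Product using (∃; _×_)
open import Relation.Nullary using (¬_)

open import Data.Bool using (Bool; true; false; _∧_; if_then_else_)
open import Data.Bool.Properties using (∧-zeroʳ)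
open import Data.Empty using (⊥-elim)
open import Data.Fin using (zero; suc)
open import Data.Nat using (zero; suc; _+_)
open import Data.Nat.Properties
  using (≤-refl; ≤-reflexive; ≤-trans; +-mono-≤; ∸-monoˡ-≤; m≤n⇒m≤n+o; m≤n⇒m≤o+n)
open import Data.Nat.Tactic.RingSolver using (solve-∀)
open import Data.Product using (_,_; proj₁; proj₂)
open import Data.Unit using (tt)
open import Data.Vec using (Vec; []; _∷_; map)
open import Function using (_∘_)
open import Function.Bundles using (_⇔_; mk⇔; Equivalence)
open import Relation.Binary.PropositionalEquality
  using (_≡_; _≢_; refl; sym; trans; cong; cong₂; module ≡-Reasoning)
open import Relation.Nullary using (Dec; yes; no; does)

open Equivalence using (to; from)

private
  variable
    n : ℕ

-- Ternary values

⌜⌝≢𝕦 : ∀ b → ⌜ b ⌝ ≢ 𝕦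
⌜⌝≢𝕦 false ()
⌜⌝≢𝕦 true  ()

⌜⌝-injective : ∀ {b c} → ⌜ b ⌝ ≡ ⌜ c ⌝ → b ≡ c
⌜⌝-injective {false} {false} _ = refl
⌜⌝-injective {true}  {true}  _ = refl

∧₃-identityʳ : ∀ s → s ∧₃ 𝟏 ≡ s
∧₃-identityʳ 𝟎 = refl
∧₃-identityʳ 𝕦 = refl
∧₃-identityʳ 𝟏 = refl

∧₃-zeroʳ : ∀ s → s ∧₃ 𝟎 ≡ 𝟎
∧₃-zeroʳ 𝟎 = refl
∧₃-zeroʳ 𝕦 = refl
∧₃-zeroʳ 𝟏 = refl

∨₃-identityʳ : ∀ s → s ∨₃ 𝟎 ≡ s
∨₃-identityʳ 𝟎 = refl
∨₃-identityʳ 𝕦 = refl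
∨₃-identityʳ 𝟏 = refl

∨₃-zeroʳ : ∀ s → s ∨₃ 𝟏 ≡ 𝟏
∨₃-zeroʳ 𝟎 = refl
∨₃-zeroʳ 𝕦 = refl
∨₃-zeroʳ 𝟏 = refl

-- The two hypotheses say t ≤ s.
∨₃-absorbs : ∀ s t → (t ≡ 𝟏 → s ≡ 𝟏) → (s ≡ 𝟎 → t ≡ 𝟎) → s ∨₃ t ≡ s
∨₃-absorbs 𝟎 t _ s⇒t = s⇒t refl
∨₃-absorbs 𝕦 𝟎 _ _   = refl
∨₃-absorbs 𝕦 𝕦 _ _   = refl
∨₃-absorbs 𝕦 𝟏 t⇒s _ = sym (t⇒s refl)
∨₃-absorbs 𝟏 t _ _   = refl

-- Once `𝟎` and `𝟏` are matched, `𝕦` is the only value left. Equations between extensions thus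
-- reduce to statements about constancy on resolutions.
≡-from-definite : ∀ s t → s ≡ 𝟎 ⇔ t ≡ 𝟎 → s ≡ 𝟏 ⇔ t ≡ 𝟏 → s ≡ t
≡-from-definite 𝟎 t zeros _    = sym (to zeros refl)
≡-from-definite 𝟏 t _     ones = sym (to ones refl)
≡-from-definite 𝕦 𝟎 zeros _    = from zeros refl
≡-from-definite 𝕦 𝕦 _     _    = refl
≡-from-definite 𝕦 𝟏 _     ones = from ones refl

-- The value of the multiplexer when the selecting variable is `𝕦`: its two literals are then both
-- `𝕦`.
consensus : Ternary → Ternary → Ternary → Ternary
consensus s t r = (𝕦 ∧₃ s) ∨₃ ((𝕦 ∧₃ t) ∨₃ r)

𝕦∧₃≢𝟏 : ∀ s → 𝕦 ∧₃ s ≢ 𝟏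
𝕦∧₃≢𝟏 𝟎 ()
𝕦∧₃≢𝟏 𝕦 ()
𝕦∧₃≢𝟏 𝟏 ()

∨₃-𝟏-right : ∀ s t → s ≢ 𝟏 → s ∨₃ t ≡ 𝟏 → t ≡ 𝟏
∨₃-𝟏-right 𝟎 _ _   eq = eq
∨₃-𝟏-right 𝕦 𝟏 _   _  = refl
∨₃-𝟏-right 𝟏 _ 𝟏≢𝟏 _  = ⊥-elim (𝟏≢𝟏 refl)

-- The disjuncts guarded by `𝕦` are at most `𝕦`, so only `r` can raise the disjunction to `𝟏`.
consensus-𝟏 : ∀ s t r → consensus s t r ≡ 𝟏 ⇔ r ≡ 𝟏
consensus-𝟏 s t r = mk⇔
  (∨₃-𝟏-right (𝕦 ∧₃ t) r (𝕦∧₃≢𝟏 t) ∘ ∨₃-𝟏-right (𝕦 ∧₃ s) _ (𝕦∧₃≢𝟏 s))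
  (λ { refl → trans (cong ((𝕦 ∧₃ s) ∨₃_) (∨₃-zeroʳ (𝕦 ∧₃ t))) (∨₃-zeroʳ (𝕦 ∧₃ s)) })

∨₃-conicalˡ : ∀ s t → s ∨₃ t ≡ 𝟎 → s ≡ 𝟎
∨₃-conicalˡ 𝟎 _ _ = refl
∨₃-conicalˡ 𝕦 𝟎 ()
∨₃-conicalˡ 𝕦 𝕦 ()
∨₃-conicalˡ 𝕦 𝟏 ()

∨₃-conicalʳ : ∀ s t → s ∨₃ t ≡ 𝟎 → t ≡ 𝟎
∨₃-conicalʳ 𝟎 _ eq = eq
∨₃-conicalʳ 𝕦 𝟎 ()
∨₃-conicalʳ 𝕦 𝕦 ()
∨₃-conicalʳ 𝕦 𝟏 ()

𝕦∧₃-conical : ∀ s → 𝕦 ∧₃ s ≡ 𝟎 → s ≡ 𝟎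
𝕦∧₃-conical 𝟎 _ = refl

consensus-𝟎⇒ : ∀ s t r → consensus s t r ≡ 𝟎 → s ≡ 𝟎 × t ≡ 𝟎
consensus-𝟎⇒ s t r eq =
  𝕦∧₃-conical s (∨₃-conicalˡ (𝕦 ∧₃ s) _ eq) ,
  𝕦∧₃-conical t (∨₃-conicalˡ (𝕦 ∧₃ t) r (∨₃-conicalʳ (𝕦 ∧₃ s) _ eq))

-- Resolutions and the hazard-free extension

∷-resolution : ∀ {b t} {a : Vec Bool n} {α} →
  (t ≢ 𝕦 → ⌜ b ⌝ ≡ t) → a ResolutionOf α → (b ∷ a) ResolutionOf (t ∷ α)
∷-resolution head tail zero    = head
∷-resolution head tail (suc i) = tail i

resolution : (α : Vec Ternary n) → ∃ (_ResolutionOf α)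
resolution []      = [] , λ ()
resolution (t ∷ α) = let (b , head) = choose t; (a , tail) = resolution α in
  b ∷ a , ∷-resolution {a = a} head tail
  where
  choose : ∀ t → ∃ λ b → t ≢ 𝕦 → ⌜ b ⌝ ≡ t
  choose 𝟎 = false , λ _ → refl
  -- An arbitrary choice: both bits resolve `𝕦`.
  choose 𝕦 = false , λ 𝕦≢𝕦 → ⊥-elim (𝕦≢𝕦 refl)
  choose 𝟏 = true , λ _ → refl

constant-unique : ∀ (f : BooleanFunction n) α {b c} →
  ConstantOnResolutions f α b → ConstantOnResolutions f α c → b ≡ c
constant-unique f α const-b const-c =
  let (a , res) = resolution α in trans (sym (const-b a res)) (const-c a res)

-- Replaces the nested tests by a specification symmetric in `false` and `true`. The test made first
-- cannot mask the second, because constants on resolutions are unique.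
extension-⇔ : ∀ (f : BooleanFunction n) α c →
  hazardFreeExtension f α ≡ ⌜ c ⌝ ⇔ ConstantOnResolutions f α c
extension-⇔ f α c =
  decided (constantOnResolutions? f α false) (constantOnResolutions? f α true) c
  where
  -- Taking the two decisions as arguments lets a match on them reduce the conditionals.
  decided : (d₀ : Dec (ConstantOnResolutions f α false))
            (d₁ : Dec (ConstantOnResolutions f α true)) → ∀ c →
    (if does d₀ then 𝟎 else if does d₁ then 𝟏 else 𝕦) ≡ ⌜ c ⌝ ⇔ ConstantOnResolutions f α c
  decided (yes const₀) _ c =
    mk⇔ (λ eq a res → trans (const₀ a res) (⌜⌝-injective eq))
        (λ const-c → cong ⌜_⌝ (constant-unique f α const₀ const-c))
  decided (no _) (yes const₁) c =
    mk⇔ (λ eq a res → trans (const₁ a res) (⌜⌝-injective eq))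
        (λ const-c → cong ⌜_⌝ (constant-unique f α const₁ const-c))
  decided (no ¬const₀) (no _) false =
    mk⇔ (λ ()) (λ const₀ → ⊥-elim (¬const₀ const₀))
  decided (no _) (no ¬const₁) true =
    mk⇔ (λ ()) (λ const₁ → ⊥-elim (¬const₁ const₁))

-- A Boolean input has itself as its only resolution.
extension-boolean : ∀ (f : BooleanFunction n) a →
  hazardFreeExtension f (map ⌜_⌝ a) ≡ ⌜ f a ⌝
extension-boolean f a =
  from (extension-⇔ f (map ⌜_⌝ a) (f a)) λ a′ res → cong f (unique a′ a res)
  where
  unique : ∀ {n} (a′ a : Vec Bool n) → a′ ResolutionOf map ⌜_⌝ a → a′ ≡ a
  unique []        []      _   = refl
  unique (b′ ∷ a′) (b ∷ a) res =
    cong₂ _∷_ (⌜⌝-injective (res zero (⌜⌝≢𝕦 b))) (unique a′ a (res ∘ suc))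

-- Restrictions of the first variable and their meet

restrict : Bool → BooleanFunction (suc n) → BooleanFunction n
restrict b f a = f (b ∷ a)

-- Universal quantification of `f` over its first variable.
meet : BooleanFunction (suc n) → BooleanFunction n
meet f a = restrict false f a ∧ restrict true f a

constant-⌜⌝∷ : ∀ (f : BooleanFunction (suc n)) b α c →
  ConstantOnResolutions f (⌜ b ⌝ ∷ α) c ⇔ ConstantOnResolutions (restrict b f) α c
constant-⌜⌝∷ f b α c = mk⇔
  (λ const-c a res → const-c (b ∷ a) (∷-resolution {a = a} (λ _ → refl) res))
  (λ { const-c (b′ ∷ a) res →
       trans (cong (λ x → f (x ∷ a)) (⌜⌝-injective (res zero (⌜⌝≢𝕦 b))))
             (const-c a (res ∘ suc)) })

constant-𝕦∷ : ∀ (f : BooleanFunction (suc n)) α c →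
  ConstantOnResolutions f (𝕦 ∷ α) c ⇔ (∀ b → ConstantOnResolutions (restrict b f) α c)
constant-𝕦∷ f α c = mk⇔
  (λ const-c b a res →
     const-c (b ∷ a) (∷-resolution {a = a} (λ 𝕦≢𝕦 → ⊥-elim (𝕦≢𝕦 refl)) res))
  (λ { const-c (b ∷ a) res → const-c b a (res ∘ suc) })

constant-meet-true : ∀ (f : BooleanFunction (suc n)) α →
  ConstantOnResolutions (meet f) α true ⇔
  (∀ b → ConstantOnResolutions (restrict b f) α true)
constant-meet-true f α = mk⇔
  (λ const₁ b a res → conjunct _ _ (const₁ a res) b a refl refl)
  (λ const₁ a res → cong₂ _∧_ (const₁ false a res) (const₁ true a res))
  where
  -- Naming the two restricted values `x` and `y` allows case analysis on their conjunction.
  conjunct : ∀ x y → x ∧ y ≡ true → ∀ b a →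
    restrict false f a ≡ x → restrict true f a ≡ y → restrict b f a ≡ true
  conjunct true true _ false a eq _ = eq
  conjunct true true _ true  a _ eq = eq

-- Only an implication: the two restrictions can be disjoint without either being constantly false.
constant-meet-false : ∀ (f : BooleanFunction (suc n)) α b →
  ConstantOnResolutions (restrict b f) α false → ConstantOnResolutions (meet f) α false
constant-meet-false f α false const₀ a res = cong (_∧ restrict true f a) (const₀ a res)
constant-meet-false f α true  const₀ a res =
  trans (cong (restrict false f a ∧_) (const₀ a res)) (∧-zeroʳ _)

extension-⌜⌝∷ : ∀ (f : BooleanFunction (suc n)) b α →
  hazardFreeExtension f (⌜ b ⌝ ∷ α) ≡ hazardFreeExtension (restrict b f) α
extension-⌜⌝∷ f b α = ≡-from-definite _ _ (definite false) (definite true)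
  where
  definite : ∀ c →
    hazardFreeExtension f (⌜ b ⌝ ∷ α) ≡ ⌜ c ⌝ ⇔ hazardFreeExtension (restrict b f) α ≡ ⌜ c ⌝
  definite c = mk⇔
    (from (extension-⇔ (restrict b f) α c) ∘ to (constant-⌜⌝∷ f b α c)
      ∘ to (extension-⇔ f (⌜ b ⌝ ∷ α) c))
    (from (extension-⇔ f (⌜ b ⌝ ∷ α) c) ∘ from (constant-⌜⌝∷ f b α c)
      ∘ to (extension-⇔ (restrict b f) α c))

-- Pointwise `meet f` lies below each restriction, and hazard-free extension preserves this order.
-- Hence the consensus term does no harm when the first variable is Boolean.
extension-meet-absorbed : ∀ (f : BooleanFunction (suc n)) b α →
  hazardFreeExtension (restrict b f) α ∨₃ hazardFreeExtension (meet f) α ≡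
  hazardFreeExtension (restrict b f) α
extension-meet-absorbed f b α = ∨₃-absorbs _ _
  (λ eq → from (extension-⇔ (restrict b f) α true)
            (to (constant-meet-true f α) (to (extension-⇔ (meet f) α true) eq) b))
  (from (extension-⇔ (meet f) α false) ∘ constant-meet-false f α b
    ∘ to (extension-⇔ (restrict b f) α false))

extension-𝕦∷ : ∀ (f : BooleanFunction (suc n)) α →
  hazardFreeExtension f (𝕦 ∷ α) ≡
  consensus (hazardFreeExtension (restrict false f) α)
            (hazardFreeExtension (restrict true f) α)
            (hazardFreeExtension (meet f) α)
extension-𝕦∷ f α = ≡-from-definite _ _ (mk⇔ zeros⇒ zeros⇐) (mk⇔ ones⇒ ones⇐)
  where
  s₀ = hazardFreeExtension (restrict false f) α
  s₁ = hazardFreeExtension (restrict true f) α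
  r  = hazardFreeExtension (meet f) α

  zeros⇒ : hazardFreeExtension f (𝕦 ∷ α) ≡ 𝟎 → consensus s₀ s₁ r ≡ 𝟎
  zeros⇒ eq =
    cong₂ _∨₃_ (cong (𝕦 ∧₃_) (from (extension-⇔ (restrict false f) α false) (const₀ false)))
      (cong₂ _∨₃_ (cong (𝕦 ∧₃_) (from (extension-⇔ (restrict true f) α false) (const₀ true)))
        -- Either restriction being constantly false already forces the meet to be so.
        (from (extension-⇔ (meet f) α false) (constant-meet-false f α false (const₀ false))))
    where
    const₀ : ∀ b → ConstantOnResolutions (restrict b f) α false
    const₀ = to (constant-𝕦∷ f α false) (to (extension-⇔ f (𝕦 ∷ α) false) eq)

  zeros⇐ : consensus s₀ s₁ r ≡ 𝟎 → hazardFreeExtension f (𝕦 ∷ α) ≡ 𝟎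
  zeros⇐ eq = from (extension-⇔ f (𝕦 ∷ α) false) (from (constant-𝕦∷ f α false) λ where
    false → to (extension-⇔ (restrict false f) α false) (proj₁ (consensus-𝟎⇒ s₀ s₁ r eq))
    true  → to (extension-⇔ (restrict true f) α false) (proj₂ (consensus-𝟎⇒ s₀ s₁ r eq)))

  ones⇒ : hazardFreeExtension f (𝕦 ∷ α) ≡ 𝟏 → consensus s₀ s₁ r ≡ 𝟏
  ones⇒ = from (consensus-𝟏 s₀ s₁ r) ∘ from (extension-⇔ (meet f) α true)
    ∘ from (constant-meet-true f α) ∘ to (constant-𝕦∷ f α true)
    ∘ to (extension-⇔ f (𝕦 ∷ α) true)

  ones⇐ : consensus s₀ s₁ r ≡ 𝟏 → hazardFreeExtension f (𝕦 ∷ α) ≡ 𝟏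
  ones⇐ = from (extension-⇔ f (𝕦 ∷ α) true) ∘ from (constant-𝕦∷ f α true)
    ∘ to (constant-meet-true f α) ∘ to (extension-⇔ (meet f) α true)
    ∘ to (consensus-𝟏 s₀ s₁ r)

-- Multiplexing with a consensus term

weaken : Formula n → Formula (suc n)
weaken (lit (pos i)) = lit (pos (suc i))
weaken (lit (neg i)) = lit (neg (suc i))
weaken (const c)     = const c
weaken (F and G)     = weaken F and weaken G
weaken (F or G)      = weaken F or weaken G

eval-weaken : ∀ (F : Formula n) t α → eval (weaken F) (t ∷ α) ≡ eval F α
eval-weaken (lit (pos i)) t α = refl
eval-weaken (lit (neg i)) t α = refl
eval-weaken (const c)     t α = refl
eval-weaken (F and G)     t α = cong₂ _∧₃_ (eval-weaken F t α) (eval-weaken G t α)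
eval-weaken (F or G)      t α = cong₂ _∨₃_ (eval-weaken F t α) (eval-weaken G t α)

size-weaken : (F : Formula n) → size (weaken F) ≡ size F
size-weaken (lit (pos i)) = refl
size-weaken (lit (neg i)) = refl
size-weaken (const c)     = refl
size-weaken (F and G)     = cong₂ _+_ (size-weaken F) (size-weaken G)
size-weaken (F or G)      = cong₂ _+_ (size-weaken F) (size-weaken G)

mux : Formula n → Formula n → Formula n → Formula (suc n)
mux F₀ F₁ F₀₁ =
  (lit (neg zero) and weaken F₀) or ((lit (pos zero) and weaken F₁) or weaken F₀₁)

eval-mux : ∀ (F₀ F₁ F₀₁ : Formula n) t α → eval (mux F₀ F₁ F₀₁) (t ∷ α) ≡
  ((¬₃ t) ∧₃ eval F₀ α) ∨₃ ((t ∧₃ eval F₁ α) ∨₃ eval F₀₁ α)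
eval-mux F₀ F₁ F₀₁ t α
  rewrite eval-weaken F₀ t α | eval-weaken F₁ t α | eval-weaken F₀₁ t α = refl

-- Constant leaves arise only at the base of the recursion, where no variable remains.
formula : BooleanFunction n → Formula n
formula {zero}  f = const (f [])
formula {suc n} f = mux (formula (restrict false f)) (formula (restrict true f)) (formula (meet f))

eval-formula : ∀ (f : BooleanFunction n) α → eval (formula f) α ≡ hazardFreeExtension f α
eval-formula {zero}  f []      = sym (extension-boolean f [])
eval-formula {suc n} f (t ∷ α)
  rewrite eval-mux (formula (restrict false f)) (formula (restrict true f)) (formula (meet f)) t α
        | eval-formula (restrict false f) α
        | eval-formula (restrict true f) α
        | eval-formula (meet f) α
  = by-head t
  where
  by-head : ∀ t →
    ((¬₃ t) ∧₃ hazardFreeExtension (restrict false f) α)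
      ∨₃ ((t ∧₃ hazardFreeExtension (restrict true f) α) ∨₃ hazardFreeExtension (meet f) α)
    ≡ hazardFreeExtension f (t ∷ α)
  -- For a Boolean head the branch not selected computes away, leaving the selected restriction
  -- joined with the meet.
  by-head 𝟎 = trans (extension-meet-absorbed f false α) (sym (extension-⌜⌝∷ f false α))
  by-head 𝕦 = sym (extension-𝕦∷ f α)
  by-head 𝟏 = trans (extension-meet-absorbed f true α) (sym (extension-⌜⌝∷ f true α))

-- Counting one extra leaf turns the recurrence into pure tripling and avoids truncated subtraction
-- in the induction.
size-formula : (f : BooleanFunction n) → suc (size (formula f)) ≡ 2 * 3 ^ n
size-formula {zero}  f = refl
size-formula {suc n} f = begin
  suc (suc (size (weaken F₀)) + (suc (size (weaken F₁)) + size (weaken F₀₁)))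
    ≡⟨ regroup (size (weaken F₀)) (size (weaken F₁)) (size (weaken F₀₁)) ⟩
  suc (size (weaken F₀)) + (suc (size (weaken F₁)) + suc (size (weaken F₀₁)))
    ≡⟨ cong₂ _+_ (suc-size (restrict false f))
        (cong₂ _+_ (suc-size (restrict true f)) (suc-size (meet f))) ⟩
  2 * 3 ^ n + (2 * 3 ^ n + 2 * 3 ^ n)
    ≡⟨ triple (3 ^ n) ⟩
  2 * 3 ^ suc n ∎
  where
  open ≡-Reasoning
  F₀  = formula (restrict false f)
  F₁  = formula (restrict true f)
  F₀₁ = formula (meet f)

  suc-size : ∀ g → suc (size (weaken (formula g))) ≡ 2 * 3 ^ n
  suc-size g = trans (cong suc (size-weaken (formula g))) (size-formula g)

  -- The two selector leaves and the extra one are dealt out, one to each subformula.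
  regroup : ∀ x y z → suc (suc x + (suc y + z)) ≡ suc x + (suc y + suc z)
  regroup = solve-∀

  triple : ∀ k → 2 * k + (2 * k + 2 * k) ≡ 2 * (3 * k)
  triple = solve-∀

-- Constant folding

-- Values must agree on all ternary inputs, not just Boolean ones, so that hazard-freeness carries
-- over.
record _FoldsTo_ (F G : Formula n) : Set where
  field
    same-value : ∀ α → eval G α ≡ eval F α
    no-larger  : size G ≤ size F

open _FoldsTo_

data Folded {n} (F : Formula n) : Set where
  constant : ∀ c → F FoldsTo const c → Folded F
  literals : ∀ G → OnlyLiteralLeaves G → F FoldsTo G → Folded F

FoldsTo-trans : {F G H : Formula n} → F FoldsTo G → G FoldsTo H → F FoldsTo H
FoldsTo-trans p q .same-value α = trans (same-value q α) (same-value p α)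
FoldsTo-trans p q .no-larger    = ≤-trans (no-larger q) (no-larger p)

Folded-from : {F G : Formula n} → F FoldsTo G → Folded G → Folded F
Folded-from p (constant c q)      = constant c (FoldsTo-trans p q)
Folded-from p (literals G only q) = literals G only (FoldsTo-trans p q)

-- A constant operand either decides the conjunction or is neutral for it, so no constant survives
-- below a gate. Both laws hold for `𝕦` as well.
fold-and : {F G : Formula n} → Folded F → Folded G → Folded (F and G)
fold-and {G = G} (constant false p) _ = constant false λ where
  .same-value α → cong (_∧₃ eval G α) (same-value p α)
  .no-larger    → m≤n⇒m≤n+o (size G) (no-larger p)
fold-and {F = F} {G} (constant true p) folded = Folded-from F∧G⇝G folded
  where
  F∧G⇝G : (F and G) FoldsTo G
  F∧G⇝G .same-value α = cong (_∧₃ eval G α) (same-value p α)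
  F∧G⇝G .no-larger    = m≤n⇒m≤o+n (size F) ≤-refl
fold-and {F = F} (literals _ _ _) (constant false q) = constant false λ where
  .same-value α → trans (sym (∧₃-zeroʳ (eval F α))) (cong (eval F α ∧₃_) (same-value q α))
  .no-larger    → m≤n⇒m≤o+n (size F) (no-larger q)
fold-and {F = F} {G} (literals F′ only p) (constant true q) = literals F′ only λ where
  .same-value α → trans (sym (∧₃-identityʳ (eval F′ α)))
                        (cong₂ _∧₃_ (same-value p α) (same-value q α))
  .no-larger    → m≤n⇒m≤n+o (size G) (no-larger p)
fold-and (literals F′ onlyF p) (literals G′ onlyG q) = literals (F′ and G′) (onlyF , onlyG) λ where
  .same-value α → cong₂ _∧₃_ (same-value p α) (same-value q α)
  .no-larger    → +-mono-≤ (no-larger p) (no-larger q)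

fold-or : {F G : Formula n} → Folded F → Folded G → Folded (F or G)
fold-or {G = G} (constant true p) _ = constant true λ where
  .same-value α → cong (_∨₃ eval G α) (same-value p α)
  .no-larger    → m≤n⇒m≤n+o (size G) (no-larger p)
fold-or {F = F} {G} (constant false p) folded = Folded-from F∨G⇝G folded
  where
  F∨G⇝G : (F or G) FoldsTo G
  F∨G⇝G .same-value α = cong (_∨₃ eval G α) (same-value p α)
  F∨G⇝G .no-larger    = m≤n⇒m≤o+n (size F) ≤-refl
fold-or {F = F} (literals _ _ _) (constant true q) = constant true λ where
  .same-value α → trans (sym (∨₃-zeroʳ (eval F α))) (cong (eval F α ∨₃_) (same-value q α))
  .no-larger    → m≤n⇒m≤o+n (size F) (no-larger q)
fold-or {F = F} {G} (literals F′ only p) (constant false q) = literals F′ only λ where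
  .same-value α → trans (sym (∨₃-identityʳ (eval F′ α)))
                        (cong₂ _∨₃_ (same-value p α) (same-value q α))
  .no-larger    → m≤n⇒m≤n+o (size G) (no-larger p)
fold-or (literals F′ onlyF p) (literals G′ onlyG q) = literals (F′ or G′) (onlyF , onlyG) λ where
  .same-value α → cong₂ _∨₃_ (same-value p α) (same-value q α)
  .no-larger    → +-mono-≤ (no-larger p) (no-larger q)

FoldsTo-refl : {F : Formula n} → F FoldsTo F
FoldsTo-refl .same-value α = refl
FoldsTo-refl .no-larger    = ≤-refl

fold-constants : (F : Formula n) → Folded F
fold-constants (lit ℓ)   = literals (lit ℓ) tt FoldsTo-refl
fold-constants (const c) = constant c FoldsTo-refl
fold-constants (F and G) = fold-and (fold-constants F) (fold-constants G)
fold-constants (F or G)  = fold-or (fold-constants F) (fold-constants G)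

-- Correctness on Boolean inputs is a special case of agreement with the extension, which restricts
-- to `f` there.
hazardFree : ∀ {f : BooleanFunction n} {G} → formula f FoldsTo G → G HazardFreeFor f
hazardFree {f = f} {G} p = (λ a → trans (extends (map ⌜_⌝ a)) (extension-boolean f a)) , extends
  where
  extends : ∀ α → eval G α ≡ hazardFreeExtension f α
  extends α = trans (same-value p α) (eval-formula f α)

size-bound : ∀ {f : BooleanFunction n} {G} → formula f FoldsTo G → size G ≤ 2 * 3 ^ n ∸ 1
size-bound {f = f} p =
  ≤-trans (no-larger p) (∸-monoˡ-≤ 1 (≤-reflexive (size-formula f)))

mainTheorem5 : (n : ℕ) → 1 ≤ n → (f : BooleanFunction n) →
    ∃ λ (F : Formula n) →
    F HazardFreeFor f
    × size F ≤ 2 * 3 ^ n ∸ 1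
    × (¬ IsConstant f → OnlyLiteralLeaves F)
mainTheorem5 n _ f with fold-constants (formula f)
... | constant c p = const c , hazardFree p , size-bound p ,
      -- A constant formula that computes `f` exhibits `f` as constant, contradicting the
      -- assumption.
      λ ¬constant → ⊥-elim (¬constant (c , λ a → sym (⌜⌝-injective (proj₁ (hazardFree p) a))))
... | literals G only p = G , hazardFree p , size-bound p , λ _ → only
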